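{- Let $p$ be an odd prime and let $k$ be an integer with $2\le k\le p-1$. Let $k^{ -1}$ denote the least non-negative integer congruent to the inverse of $k$ modulo $p$, and let $K=\min\{k,k^{ -1}\}$. If $T$ is an orthogonal trade in $B_p$ of index $(1,k)$, then every symbol that occurs in $T$ occurs in $T$ more than $\log_K(p)+1$ times.
   Context: All arithmetic is modulo $p$. A Latin square of order $p$ is viewed as a set of (row, column, symbol) triples in $\mathbb{Z}_p^3$. For $1\le k\le p-1$, $B_p(k)$ is the Latin square with symbol $ki+j$ in cell $(i,j)$, $i,j\in\mathbb{Z}_p$; $B_p=B_p(1)$. A Latin trade in a Latin square $L$ is a subset $T\subseteq L$ for which there is a partial Latin square $T'$ (a disjoint mate) such that $T$ and $T'$ occupy the same set of cells, $T\cap T'=\emptyset$, and each row (respectively column) of $T$ contains the same set of symbols as the corresponding row (column) of $T'$. Two Latin squares of order $p$ are orthogonal if superimposing them yields each of the $p^2$ ordered pairs exactly once. An orthogonal trade of index $(\ell,k)$ is a Latin trade $T\subseteq B_p(\ell)$ having a disjoint mate $T'$ such that $(B_p(\ell)\setminus T)\cup T'$ is orthogonal to $B_p(k)$. -}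

module Defs where

open import Data.Fin using (Fin; toℕ)
open import Data.List using (length; filter; allFin; cartesianProduct)
open import Data.Nat using (ℕ; NonZero; _+_; _*_; _^_; _≤_; _<_)
open import Data.Nat.DivMod using (_%_; _mod_)
open import Data.Product using (_×_; _,_; ∃!; ∃-syntax)
open import Function.Bundles using (_⇔_)
open import Level using (0ℓ)
open import Relation.Binary.PropositionalEquality using (_≡_)
open import Relation.Unary using (Pred; Decidable; _⊆_; _∪_; _∖_; _⊥_)

-- ℤ_n is represented by the residues Fin n; a triple is (row , column , symbol).
Triple : ℕ → Set
Triple n = Fin n × Fin n × Fin n

TripleSet : ℕ → Set₁
TripleSet n = Pred (Triple n) 0ℓ

record IsPartialLatinSquare {n : ℕ} (P : TripleSet n) : Set where
  field
    cell-unique : ∀ {i j s s′} → P (i , j , s) → P (i , j , s′) → s ≡ s′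
    row-unique  : ∀ {i j j′ s} → P (i , j , s) → P (i , j′ , s) → j ≡ j′
    col-unique  : ∀ {i i′ j s} → P (i , j , s) → P (i′ , j , s) → i ≡ i′

record IsLatinSquare {n : ℕ} (L : TripleSet n) : Set where
  field
    cell : ∀ i j → ∃! _≡_ λ s → L (i , j , s)
    row  : ∀ i s → ∃! _≡_ λ j → L (i , j , s)
    col  : ∀ j s → ∃! _≡_ λ i → L (i , j , s)

B : (p : ℕ) .{{_ : NonZero p}} → ℕ → TripleSet p
B p k (i , j , s) = s ≡ (k * toℕ i + toℕ j) mod p

record Orthogonal {n : ℕ} (L M : TripleSet n) : Set where
  field
    latinˡ      : IsLatinSquare L
    latinʳ      : IsLatinSquare M
    superimpose : ∀ s t → ∃! _≡_ λ ((i , j) : Fin n × Fin n) → L (i , j , s) × M (i , j , t)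

record IsDisjointMate {n : ℕ} (T T′ : TripleSet n) : Set where
  field
    partialLatin : IsPartialLatinSquare T′
    sameCells    : ∀ i j → (∃[ s ] T (i , j , s)) ⇔ (∃[ s ] T′ (i , j , s))
    disjoint     : T ⊥ T′
    sameInRow    : ∀ i s → (∃[ j ] T (i , j , s)) ⇔ (∃[ j ] T′ (i , j , s))
    sameInCol    : ∀ j s → (∃[ i ] T (i , j , s)) ⇔ (∃[ i ] T′ (i , j , s))

record IsOrthogonalTrade (p : ℕ) .{{_ : NonZero p}} (ℓ k : ℕ) (T : TripleSet p) : Set₁ where
  field
    subset     : T ⊆ B p ℓ
    mate       : TripleSet p
    isMate     : IsDisjointMate T mate
    orthogonal : Orthogonal ((B p ℓ ∖ T) ∪ mate) (B p k)

OccursIn : {n : ℕ} → Fin n → TripleSet n → Set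
OccursIn s T = ∃[ i ] ∃[ j ] T (i , j , s)

-- Decidability is what makes a predicate on Triple n a finite set whose
-- elements can be counted.
occurrences : {n : ℕ} {T : TripleSet n} → Decidable T → Fin n → ℕ
occurrences {n} T? s =
  length (filter (λ (i , j) → T? (i , j , s)) (cartesianProduct (allFin n) (allFin n)))

record IsLeastInverse (p : ℕ) .{{_ : NonZero p}} (k k⁻¹ : ℕ) : Set where
  field
    inverse : (k * k⁻¹) % p ≡ 1 % p
    least   : ∀ m → (k * m) % p ≡ 1 % p → k⁻¹ ≤ m

-- The real inequality n > log_b(x) + 1 for b ≥ 2 and x ≥ 1, with both sides
-- exponentiated to base b: b ^ n > b ^ (log_b(x) + 1) = b * x.
_>log[_]_+1 : ℕ → ℕ → ℕ → Set
n >log[ b ] x +1 = b * x < b ^ n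

{-# OPTIONS --safe #-}
module Submission where

-- Let r₁, …, rₙ be the rows of T holding s. In the mate, s is permuted among
-- these rows and the columns of its cells, and orthogonality to B_p(k) forces
-- the same set of k-symbols on both sets of cells; this yields permutations
-- σ, τ with σ fixed-point-free and k r_a = r_σ(a) + (k − 1) r_τ(a) mod p.
-- Read the relation as a chip-firing rule: k chips at a are traded for one at
-- σ(a) and k − 1 at τ(a), which preserves the sum of r over all chips. Shift r
-- to vanish at a sink. Starting from any number of chips on a vertex a that
-- σ sends to the sink, firing until every other vertex has fewer than k chips
-- represents each multiple of r_a, hence each residue mod p, by one of k^(n−1)
-- stable configurations. Firing stops because σ and τ are permutations of a
-- finite set, so that every vertex reachable from a also reaches the sink.
-- So p ≤ k^(n−1), strictly since p is prime and k < p.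
-- Multiplying the relation by k⁻¹ gives one of the same shape for k⁻¹ in which
-- σ(a) plays the role of a.

open import Defs
open import Data.Fin using (Fin; zero; suc; toℕ; fromℕ<; punchIn; punchOut; funToFin; finToFun)
open import Data.Fin.Properties using (toℕ<n; toℕ-fromℕ<; fromℕ<-injective; toℕ-injective; pigeonhole; any?; punchInᵢ≢i; punchIn-punchOut; finToFun-funToFin)
import Data.Fin.Properties as Fin
open import Data.List using (List; filter; lookup; allFin; cartesianProduct)
open import Data.List.Membership.Propositional.Properties using (∈-filter⁺; ∈-filter⁻; ∈-cartesianProduct⁺; ∈-allFin; ∈-lookup)
open import Data.List.Relation.Unary.All using () renaming (lookup to All-lookup)
open import Data.List.Relation.Unary.AllPairs using (_∷_)
open import Data.List.Relation.Unary.Any using (index)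
open import Data.List.Relation.Unary.Any.Properties using (lookup-index)
open import Data.List.Relation.Unary.Unique.Propositional using (Unique)
open import Data.List.Relation.Unary.Unique.Propositional.Properties using (filter⁺; cartesianProduct⁺; allFin⁺)
open import Data.Nat using (ℕ; zero; suc; NonZero; _+_; _*_; _^_; _∸_; _⊓_; _⊔_; _≤_; _<_; z≤n; s≤s; z<s; pred; _≤?_; _≤′_; ≤′-refl; ≤′-step; >-nonZero)
open import Data.Nat.DivMod using (_%_; _mod_; %-distribˡ-+; %-distribˡ-*; [m+kn]%n≡m%n; m%n%n≡m%n; m%n<n; m*n%n≡0; m<n⇒m%n≡m)
open import Data.Nat.Divisibility using (_∣_; _∤_; m∣m*n; n∣m⇒m%n≡0; m%n≡0⇒n∣m; >⇒∤)
open import Data.Nat.GeneralisedArithmetic using (fold; fold-+)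
open import Data.Nat.Induction using (<-wellFounded)
open import Data.Nat.Primality using (Prime; euclidsLemma; prime⇒irreducible)
open import Data.Nat.Properties
open import Data.Nat.Tactic.RingSolver using (solve-∀)
open import Data.Product using (∃; _×_; _,_; proj₁; proj₂)
open import Data.Sum using (_⊎_; inj₁; inj₂)
open import Function.Bundles using (Equivalence)
open import Function using (id; _∘_; _⟨_⟩_)
open import Function.Definitions using (Injective)
open import Induction.WellFounded using (Acc; acc)
open import Relation.Binary using (tri<; tri≈; tri>)
open import Relation.Binary.PropositionalEquality
open import Relation.Nullary using (¬_; yes; no; contradiction; ¬?)
open import Relation.Nullary.Decidable using (_×-dec_; ¬¬-excluded-middle)
open import Relation.Unary using (Decidable)

open import Algebra.Properties.Semiring.Sum +-*-semiring using (sum; sum-cong-≗; ∑-distrib-+)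

-- Congruences modulo `p` between natural numbers.

infix 4 _≈_[mod_]

_≈_[mod_] : ℕ → ℕ → (p : ℕ) .{{_ : NonZero p}} → Set
a ≈ b [mod p ] = a % p ≡ b % p

module _ {p : ℕ} .{{_ : NonZero p}} where

  +-mod-cong : ∀ {a b c d} → a ≈ b [mod p ] → c ≈ d [mod p ] → a + c ≈ b + d [mod p ]
  +-mod-cong {a} {b} {c} {d} a≈b c≈d = begin
    (a + c) % p          ≡⟨ %-distribˡ-+ a c p ⟩
    (a % p + c % p) % p  ≡⟨ cong₂ (λ x y → (x + y) % p) a≈b c≈d ⟩
    (b % p + d % p) % p  ≡⟨ %-distribˡ-+ b d p ⟨
    (b + d) % p          ∎
    where open ≡-Reasoning

  *-mod-congˡ : ∀ m {a b} → a ≈ b [mod p ] → m * a ≈ m * b [mod p ]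
  *-mod-congˡ m {a} {b} a≈b = begin
    (m * a) % p            ≡⟨ %-distribˡ-* m a p ⟩
    (m % p * (a % p)) % p  ≡⟨ cong (λ x → (m % p * x) % p) a≈b ⟩
    (m % p * (b % p)) % p  ≡⟨ %-distribˡ-* m b p ⟨
    (m * b) % p            ∎
    where open ≡-Reasoning

  *-mod-congʳ : ∀ m {a b} → a ≈ b [mod p ] → a * m ≈ b * m [mod p ]
  *-mod-congʳ m {a} {b} a≈b = subst₂ _≈_[mod p ] (*-comm m a) (*-comm m b) (*-mod-congˡ m a≈b)

  +-mod-cancelʳ : ∀ c {a b} → a + c ≈ b + c [mod p ] → a ≈ b [mod p ]
  +-mod-cancelʳ c {a} {b} a+c≈b+c = begin
    a % p                      ≡⟨ drop a ⟨
    -- Adding `c * pred p` completes `c` to the multiple `c * p`, which serves as subtraction of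
    -- `c`.
    (a + c + c * pred p) % p   ≡⟨ +-mod-cong a+c≈b+c refl ⟩
    (b + c + c * pred p) % p   ≡⟨ drop b ⟩
    b % p                      ∎
    where
    open ≡-Reasoning
    drop : ∀ x → (x + c + c * pred p) % p ≡ x % p
    drop x = begin
      (x + c + c * pred p) % p    ≡⟨ cong (_% p) (+-assoc x c _) ⟩
      (x + (c + c * pred p)) % p  ≡⟨ cong (λ y → (x + y) % p) (*-suc c (pred p)) ⟨
      (x + c * suc (pred p)) % p  ≡⟨ cong (λ y → (x + c * y) % p) (suc-pred p) ⟩
      (x + c * p) % p             ≡⟨ [m+kn]%n≡m%n x c p ⟩
      x % p                       ∎

  <⇒mod-inj : ∀ {x y} → x < p → y < p → x ≈ y [mod p ] → x ≡ y
  <⇒mod-inj x<p y<p x≈y = trans (sym (m<n⇒m%n≡m x<p)) (trans x≈y (m<n⇒m%n≡m y<p))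

  -- By Euclid's lemma `p` would divide `d` or `y ∸ x`, and the latter lies strictly between 0 and
  -- `p`.
  *-mod-cancelˡ-< : Prime p → ∀ {d} → p ∤ d → ∀ {x y} → x < y → y < p → ¬ (d * x ≈ d * y [mod p ])
  *-mod-cancelˡ-< p-prime {d} p∤d {x} {y} x<y y<p dx≈dy
    with euclidsLemma d (y ∸ x) p-prime (m%n≡0⇒n∣m _ p d[y∸x]≈0)
    where
    d[y∸x]≈0 : d * (y ∸ x) % p ≡ 0
    d[y∸x]≈0 = trans (+-mod-cancelʳ (d * x) {b = 0} (begin
      (d * (y ∸ x) + d * x) % p  ≡⟨ cong (_% p) (*-distribˡ-+ d (y ∸ x) x) ⟨
      d * (y ∸ x + x) % p        ≡⟨ cong (λ z → d * z % p) (m∸n+n≡m (<⇒≤ x<y)) ⟩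
      d * y % p                  ≡⟨ dx≈dy ⟨
      d * x % p                  ∎)) (m*n%n≡0 0 p)
      where open ≡-Reasoning
  ... | inj₁ p∣d = p∤d p∣d
  ... | inj₂ p∣y∸x = >⇒∤ {{>-nonZero (m<n⇒0<n∸m x<y)}} (≤-<-trans (m∸n≤m y x) y<p) p∣y∸x

  *-mod-cancelˡ : Prime p → ∀ {d} → p ∤ d → ∀ {x y} → x < p → y < p →
                  d * x ≈ d * y [mod p ] → x ≡ y
  *-mod-cancelˡ p-prime p∤d {x} {y} x<p y<p dx≈dy with <-cmp x y
  ... | tri< x<y _ _ = contradiction dx≈dy (*-mod-cancelˡ-< p-prime p∤d x<y y<p)
  ... | tri≈ _ x≡y _ = x≡y
  ... | tri> _ _ y<x = contradiction (sym dx≈dy) (*-mod-cancelˡ-< p-prime p∤d y<x x<p)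

-- Finite sets: recurrence of injective maps, uniform bounds, pigeonhole.

fold-suc : ∀ {A : Set} (f : A → A) d x → fold (f x) f d ≡ f (fold x f d)
fold-suc f zero    x = refl
fold-suc f (suc d) x = cong f (fold-suc f d x)

fold-injective : ∀ {A : Set} {f : A → A} → Injective _≡_ _≡_ f →
                 ∀ d {x y} → fold x f d ≡ fold y f d → x ≡ y
fold-injective f-inj zero    eq = eq
fold-injective f-inj (suc d) eq = fold-injective f-inj d (f-inj eq)

-- Two iterates of `x` coincide by the pigeonhole principle, and injectivity strips the common
-- applications of `f`. Starting the fold at `f x` guarantees a return after at least one step.
recurrent : ∀ {n} {f : Fin n → Fin n} → Injective _≡_ _≡_ f → ∀ x → ∃ λ d → fold (f x) f d ≡ x
recurrent {n} {f} f-inj x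
  with i , j , i<j , eq ← pigeonhole (n<1+n n) (λ i → fold x f (toℕ i))
  with e , i+e≡j ← m≤n⇒∃[o]m+o≡n i<j =
  e , fold-injective f-inj (toℕ i) (begin
    fold (fold (f x) f e) f (toℕ i)  ≡⟨ fold-+ (f x) f (toℕ i) ⟨
    fold (f x) f (toℕ i + e)          ≡⟨ fold-suc f (toℕ i + e) x ⟩
    fold x f (suc (toℕ i + e))        ≡⟨ cong (λ m → fold x f m) i+e≡j ⟩
    fold x f (toℕ j)                  ≡⟨ eq ⟨
    fold x f (toℕ i)                  ∎)
  where open ≡-Reasoning

injective⇒surjective : ∀ {n} {f : Fin n → Fin n} → Injective _≡_ _≡_ f → ∀ x → ∃ λ y → f y ≡ x
injective⇒surjective {f = f} f-inj x with d , eq ← recurrent f-inj x =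
  fold x f d , trans (sym (fold-suc f d x)) eq

-- Since `x` lies on a cycle of `f`, iterating `f` from `f x` leads to `x`; membership is pulled
-- back along this path.
backward⇒forward : ∀ {n} {f : Fin n → Fin n} → Injective _≡_ _≡_ f → (S : Fin n → Set) →
                   (∀ {x} → S (f x) → S x) → ∀ {x} → S x → S (f x)
backward⇒forward {f = f} f-inj S back {x} Sx
  with d , eq ← recurrent f-inj x = pull d (subst S (sym eq) Sx)
  where
  pull : ∀ d {y} → S (fold y f d) → S y
  pull zero    Sy = Sy
  pull (suc d) Sy = pull d (back Sy)

-- Whether `P m x` ever holds is an unbounded search, so the common bound is only obtained under a
-- double negation. This suffices for deriving an inequality of naturals by contradiction.
¬¬-uniform : ∀ {n} (P : ℕ → Fin n → Set) → (∀ x {m m′} → m ≤ m′ → P m x → P m′ x) →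
             ¬ ¬ ∃ λ m → ∀ x m′ → P m′ x → P m x
¬¬-uniform {zero}  P mono ¬u = ¬u (0 , λ ())
¬¬-uniform {suc n} P mono ¬u = ¬¬-uniform (λ m → P m ∘ suc) (mono ∘ suc) λ (m , u) →
  ¬¬-excluded-middle {A = ∃ λ m₀ → P m₀ zero} λ where
    (yes (m₀ , Pm₀)) → ¬u (m ⊔ m₀ , λ where
      zero    _  _ → mono zero (m≤n⊔m m m₀) Pm₀
      (suc x) m′ q → mono (suc x) (m≤m⊔n m m₀) (u x m′ q))
    (no ¬P)          → ¬u (m , λ where
      zero    m′ q → contradiction (m′ , q) ¬P
      (suc x) m′ q → u x m′ q)

pigeonhole-→ : ∀ {k m n} → k ^ m < n → (f : Fin n → Fin m → Fin k) →
               ∃ λ i → ∃ λ j → toℕ i < toℕ j × f i ≗ f j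
pigeonhole-→ kᵐ<n f with i , j , i<j , eq ← pigeonhole kᵐ<n (funToFin ∘ f) =
  i , j , i<j , λ x → trans (sym (finToFun-funToFin (f i) x))
                        (trans (cong (λ e → finToFun e x) eq) (finToFun-funToFin (f j) x))

-- Chip configurations and their total weights.

infix 8 _·_

_·_ : ∀ {n} → (Fin n → ℕ) → (Fin n → ℕ) → ℕ
c · w = sum (λ i → c i * w i)

point : ∀ {n} → Fin n → ℕ → Fin n → ℕ
point zero    m zero    = m
point zero    m (suc _) = 0
point (suc a) m zero    = 0
point (suc a) m (suc i) = point a m i

0· : ∀ {n} (w : Fin n → ℕ) → (λ _ → 0) · w ≡ 0
0· {zero}  w = refl
0· {suc n} w = 0· (w ∘ suc)

point-· : ∀ {n} (a : Fin n) m w → point a m · w ≡ m * w a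
point-· zero    m w = trans (cong (m * w zero +_) (0· (w ∘ suc))) (+-identityʳ _)
point-· (suc a) m w = point-· a m (w ∘ suc)

+-· : ∀ {n} (c d w : Fin n → ℕ) → (λ i → c i + d i) · w ≡ c · w + d · w
+-· c d w = trans (sum-cong-≗ (λ i → *-distribʳ-+ (w i) (c i) (d i)))
                  (∑-distrib-+ (λ i → c i * w i) (λ i → d i * w i))

point-≤ : ∀ {n} (a : Fin n) {m} {c : Fin n → ℕ} → m ≤ c a → ∀ i → point a m i ≤ c i
point-≤ zero    m≤ca zero    = m≤ca
point-≤ zero    m≤ca (suc i) = z≤n
point-≤ (suc a) m≤ca zero    = z≤n
point-≤ (suc a) m≤ca (suc i) = point-≤ a m≤ca i

point-support : ∀ {n} (a : Fin n) {m i} → 0 < point a m i → i ≡ a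
point-support zero    {i = zero}  _ = refl
point-support (suc a) {i = suc i} 0<pt = cong suc (point-support a 0<pt)

+-positive : ∀ m {n} → 0 < m + n → 0 < m ⊎ 0 < n
+-positive zero    0<n = inj₂ 0<n
+-positive (suc m) _   = inj₁ z<s

-- Chip firing with a sink.

module ChipFiring {n} (σ τ : Fin n → Fin n) (k′ : ℕ) (sink : Fin n) where

  k : ℕ
  k = suc k′

  -- The truncated subtraction is exact as soon as `a` holds at least `k` chips.
  fire : Fin n → (Fin n → ℕ) → Fin n → ℕ
  fire a c i = (c i ∸ point a k i) + (point (σ a) 1 i + point (τ a) k′ i)

  -- The weight `w` is arbitrary because the identity is used twice: with `cost` for termination and
  -- with `r` for the invariant modulo `p`.
  fire-· : ∀ a {c} → k ≤ c a → ∀ w → fire a c · w + k * w a ≡ c · w + (w (σ a) + k′ * w (τ a))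
  fire-· a {c} k≤ca w = begin
    fire a c · w + k * w a
      ≡⟨ cong (_+ k * w a) (+-· rest gain w) ⟩
    rest · w + gain · w + k * w a
      ≡⟨ swap (rest · w) (gain · w) (k * w a) ⟩
    rest · w + k * w a + gain · w
      ≡⟨ cong₂ _+_ rest-· gain-· ⟩
    c · w + (w (σ a) + k′ * w (τ a)) ∎
    where
    open ≡-Reasoning
    rest gain : Fin n → ℕ
    rest i = c i ∸ point a k i
    gain i = point (σ a) 1 i + point (τ a) k′ i
    swap : ∀ x y z → x + y + z ≡ x + z + y
    swap = solve-∀
    rest-· : rest · w + k * w a ≡ c · w
    rest-· = begin
      rest · w + k * w a              ≡⟨ cong (rest · w +_) (point-· a k w) ⟨
      rest · w + point a k · w        ≡⟨ +-· rest (point a k) w ⟨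
      (λ i → rest i + point a k i) · w
        ≡⟨ sum-cong-≗ (λ i → cong (_* w i) (m∸n+n≡m (point-≤ a k≤ca i))) ⟩
      c · w                           ∎
    gain-· : gain · w ≡ w (σ a) + k′ * w (τ a)
    gain-· = trans (+-· (point (σ a) 1) (point (τ a) k′) w)
               (cong₂ _+_ (trans (point-· (σ a) 1 w) (*-identityˡ _)) (point-· (τ a) k′ w))

  module _ (S : Fin n → Set) (S-σ : ∀ {a} → S a → S (σ a)) (S-τ : ∀ {a} → S a → S (τ a))
           (cost : Fin n → ℕ)
           (cost-drops : ∀ {a} → S a → a ≢ sink → cost (σ a) + k′ * cost (τ a) < k * cost a)
           {p : ℕ} .{{_ : NonZero p}} (r : Fin n → ℕ)
           (harmonic : ∀ a → k * r a ≈ r (σ a) + k′ * r (τ a) [mod p ])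
           where

    -- `S` is the region where firing is known to lower the cost. Its closure under `σ` and `τ`
    -- keeps the chips inside it.
    Supported : (Fin n → ℕ) → Set
    Supported c = ∀ i → 0 < c i → S i

    fire-supported : ∀ {a c} → S a → Supported c → Supported (fire a c)
    fire-supported {a} {c} Sa c⊆S i 0<
      with +-positive (c i ∸ point a k i) 0<
    ... | inj₁ 0<rest = c⊆S i (<-≤-trans 0<rest (m∸n≤m (c i) (point a k i)))
    ... | inj₂ 0<gain with +-positive (point (σ a) 1 i) 0<gain
    ...   | inj₁ 0<σ = subst S (sym (point-support (σ a) 0<σ)) (S-σ Sa)
    ...   | inj₂ 0<τ = subst S (sym (point-support (τ a) 0<τ)) (S-τ Sa)

    fire-cheaper : ∀ {a c} → S a → a ≢ sink → k ≤ c a → fire a c · cost < c · cost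
    fire-cheaper {a} {c} Sa a≢sink k≤ca = +-cancelʳ-< (k * cost a) _ _ (begin-strict
      fire a c · cost + k * cost a               ≡⟨ fire-· a k≤ca cost ⟩
      c · cost + (cost (σ a) + k′ * cost (τ a))  <⟨ +-monoʳ-< (c · cost) (cost-drops Sa a≢sink) ⟩
      c · cost + k * cost a                      ∎)
      where open ≤-Reasoning

    fire-≈ : ∀ a {c} → k ≤ c a → fire a c · r ≈ c · r [mod p ]
    fire-≈ a {c} k≤ca = +-mod-cancelʳ (k * r a) (begin
      (fire a c · r + k * r a) % p            ≡⟨ cong (_% p) (fire-· a k≤ca r) ⟩
      (c · r + (r (σ a) + k′ * r (τ a))) % p  ≡⟨ +-mod-cong {a = c · r} refl (harmonic a) ⟨
      (c · r + k * r a) % p                   ∎)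
      where open ≡-Reasoning

    -- Each firing lowers the total cost, a natural number, and keeps the total of `r` modulo `p`.
    -- The sink never fires, so its number of chips stays unbounded.
    stabilise : ∀ c → Supported c → Acc _<_ (c · cost) →
                ∃ λ c′ → (∀ i → i ≢ sink → c′ i < k) × c′ · r ≈ c · r [mod p ]
    stabilise c c⊆S (acc rec) with any? (λ i → ¬? (i Fin.≟ sink) ×-dec (k ≤? c i))
    ... | no unstable∄ = c , (λ i i≢sink → ≰⇒> λ k≤ci → unstable∄ (i , i≢sink , k≤ci)) , refl
    ... | yes (a , a≢sink , k≤ca)
      with Sa ← c⊆S a (<-≤-trans z<s k≤ca)
      with c′ , stable , c′≈ ← stabilise (fire a c) (fire-supported Sa c⊆S)
                                         (rec (fire-cheaper Sa a≢sink k≤ca)) =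
      c′ , stable , trans c′≈ (fire-≈ a k≤ca)

  -- Firing a vertex that reaches the sink increases the total height, because
  -- one of its successors is at least 1 + k times as high:
  -- height m x = (1 + k) ^ (m ∸ d) if the shortest path of σ- and τ-steps
  -- from x to the sink has length d ≤ m, and 0 if there is no such path.
  height : ℕ → Fin n → ℕ
  height m       x with x Fin.≟ sink
  height m       x | yes _ = suc k ^ m
  height zero    x | no  _ = 0
  height (suc m) x | no  _ = height m (σ x) ⊔ height m (τ x)

  height-sink : ∀ m → height m sink ≡ suc k ^ m
  height-sink m with sink Fin.≟ sink
  ... | yes _   = refl
  ... | no  s≢s = contradiction refl s≢s

  height-step : ∀ m {x} → x ≢ sink → height (suc m) x ≡ height m (σ x) ⊔ height m (τ x)
  height-step m {x} x≢s with x Fin.≟ sink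
  ... | yes x≡s = contradiction x≡s x≢s
  ... | no  _   = refl

  -- Off the sink, the right-hand side is the larger height of the two successors at level `m`; this
  -- gives the successor `1 + k` times as high as `x`.
  height-grows : ∀ m x → suc k * height m x ≤ height (suc m) x
  height-grows m x with x Fin.≟ sink
  height-grows m       x | yes _ = ≤-refl
  height-grows zero    x | no  _ = subst (_≤ height zero (σ x) ⊔ height zero (τ x)) (sym (*-zeroʳ (suc k))) z≤n
  height-grows (suc m) x | no  _ = ≤-trans
    (≤-reflexive (*-distribˡ-⊔ (suc k) (height m (σ x)) (height m (τ x))))
    (⊔-mono-≤ (height-grows m (σ x)) (height-grows m (τ x)))

  height-≤ : ∀ m x → height m x ≤ suc k ^ m
  height-≤ m       x with x Fin.≟ sink
  height-≤ m       x | yes _ = ≤-refl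
  height-≤ zero    x | no  _ = z≤n
  height-≤ (suc m) x | no  _ = ≤-trans (⊔-lub (height-≤ m (σ x)) (height-≤ m (τ x)))
                                       (m≤m+n (suc k ^ m) (k * suc k ^ m))

  Reaches : ℕ → Fin n → Set
  Reaches m x = 0 < height m x

  reaches-mono : ∀ x {m m′} → m ≤′ m′ → Reaches m x → Reaches m′ x
  reaches-mono x           ≤′-refl        q = q
  reaches-mono x {m′ = suc m′} (≤′-step m≤m′) q =
    <-≤-trans (reaches-mono x m≤m′ q) (≤-trans (m≤m+n _ _) (height-grows m′ x))

  reaches-sink : ∀ m → Reaches m sink
  reaches-sink m = subst (0 <_) (sym (height-sink m)) (m^n>0 (suc k) m)

  reaches-backˡ : ∀ {m x} → Reaches m (σ x) → Reaches (suc m) x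
  reaches-backˡ {m} {x} q with x Fin.≟ sink
  ... | yes _ = m^n>0 (suc k) (suc m)
  ... | no  _ = m≤n⇒m≤n⊔o _ q

  reaches-backʳ : ∀ {m x} → Reaches m (τ x) → Reaches (suc m) x
  reaches-backʳ {m} {x} q with x Fin.≟ sink
  ... | yes _ = m^n>0 (suc k) (suc m)
  ... | no  _ = m≤n⇒m≤o⊔n _ q

  -- The cost is the height subtracted from its maximum. A firing removes as many chips as it adds,
  -- so the maxima cancel and the gain in height becomes a loss in cost. As `k′` is at least 1, a
  -- high successor counts even if it is `τ x`.
  descent : .{{_ : NonZero k′}} → ∀ m {x} → Reaches m x → x ≢ sink →
            let cost = λ y → suc k ^ m ∸ height m y in
            cost (σ x) + k′ * cost (τ x) < k * cost x
  descent m {x} q x≢s = +-cancelʳ-< (k * h x) _ _ (begin-strict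
    cost (σ x) + k′ * cost (τ x) + k * h x
      <⟨ +-monoʳ-< (cost (σ x) + k′ * cost (τ x)) kh< ⟩
    cost (σ x) + k′ * cost (τ x) + (h (σ x) + k′ * h (τ x))
      ≡⟨ regroup (cost (σ x)) (cost (τ x)) (h (σ x)) (h (τ x)) k′ ⟩
    (cost (σ x) + h (σ x)) + k′ * (cost (τ x) + h (τ x))
      ≡⟨ cong₂ (λ y z → y + k′ * z) (m∸n+n≡m (height-≤ m (σ x))) (m∸n+n≡m (height-≤ m (τ x))) ⟩
    k * suc k ^ m
      ≡⟨ cong (k *_) (m∸n+n≡m (height-≤ m x)) ⟨
    k * (cost x + h x)
      ≡⟨ *-distribˡ-+ k (cost x) (h x) ⟩
    k * cost x + k * h x ∎)
    where
    open ≤-Reasoning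
    h cost : Fin n → ℕ
    h = height m
    cost y = suc k ^ m ∸ h y
    regroup : ∀ a b c d e → a + e * b + (c + e * d) ≡ a + c + e * (b + d)
    regroup = solve-∀
    kh< : k * h x < h (σ x) + k′ * h (τ x)
    kh< = begin-strict
      k * h x                 <⟨ m<n+m (k * h x) q ⟩
      suc k * h x             ≤⟨ height-grows m x ⟩
      height (suc m) x        ≡⟨ height-step m x≢s ⟩
      h (σ x) ⊔ h (τ x)       ≤⟨ m⊔n≤m+n (h (σ x)) (h (τ x)) ⟩
      h (σ x) + h (τ x)       ≤⟨ +-monoʳ-≤ (h (σ x)) (m≤n*m (h (τ x)) k′) ⟩
      h (σ x) + k′ * h (τ x)  ∎

-- Counting stable configurations.

module _ {p : ℕ} .{{_ : NonZero p}} (p-prime : Prime p) where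

  module _ {n k : ℕ} (r : Fin (suc n) → ℕ) {sink : Fin (suc n)} (r-sink≡0 : r sink ≡ 0)
           {x : ℕ} (p∤x : p ∤ x)
           (representable : ∀ i → ∃ λ c → (∀ a → a ≢ sink → c a < k) × c · r ≈ i * x [mod p ])
           where

    -- The sink has weight 0, so only the `n` other entries of a configuration matter; hence the
    -- exponent `n` for `suc n` vertices.
    agree-off-sink : ∀ {c d : Fin (suc n) → ℕ} → (∀ a → a ≢ sink → c a ≡ d a) → c · r ≡ d · r
    agree-off-sink {c} {d} c≡d = sum-cong-≗ same
      where
      same : ∀ a → c a * r a ≡ d a * r a
      same a with a Fin.≟ sink
      ... | no a≢s   = cong (_* r a) (c≡d a a≢s)
      ... | yes refl rewrite r-sink≡0 = trans (*-zeroʳ (c a)) (sym (*-zeroʳ (d a)))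

    chips : ℕ → Fin (suc n) → ℕ
    chips i = proj₁ (representable i)

    chips-< : ∀ i a → a ≢ sink → chips i a < k
    chips-< i = proj₁ (proj₂ (representable i))

    digits : Fin p → Fin n → Fin k
    digits i a = fromℕ< (chips-< (toℕ i) (punchIn sink a) (punchInᵢ≢i sink a))

    digits≗⇒≈ : ∀ {i j} → digits i ≗ digits j → toℕ i * x ≈ toℕ j * x [mod p ]
    digits≗⇒≈ {i} {j} eq = trans (sym (proj₂ (proj₂ (representable (toℕ i)))))
      (trans (cong (_% p) (agree-off-sink chips≡)) (proj₂ (proj₂ (representable (toℕ j)))))
      where
      chips≡ : ∀ a → a ≢ sink → chips (toℕ i) a ≡ chips (toℕ j) a
      chips≡ a a≢s = subst (λ y → chips (toℕ i) y ≡ chips (toℕ j) y) (punchIn-punchOut (a≢s ∘ sym))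
        (fromℕ<-injective _ _ _ _ (eq (punchOut (a≢s ∘ sym))))

    representable⇒p≤kⁿ : p ≤ k ^ n
    representable⇒p≤kⁿ = ≮⇒≥ λ kⁿ<p →
      let i , j , i<j , eq = pigeonhole-→ kⁿ<p digits in
      *-mod-cancelˡ-< p-prime p∤x i<j (toℕ<n j)
        (subst₂ _≈_[mod p ] (*-comm (toℕ i) x) (*-comm (toℕ j) x) (digits≗⇒≈ eq))

  module _ {n} {σ τ : Fin (suc n) → Fin (suc n)}
           (σ-inj : Injective _≡_ _≡_ σ) (τ-inj : Injective _≡_ _≡_ τ)
           {k′ : ℕ} .{{_ : NonZero k′}} (r : Fin (suc n) → ℕ)
           (harmonic : ∀ a → suc k′ * r a ≈ r (σ a) + k′ * r (τ a) [mod p ])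
           (a : Fin (suc n)) (r-σa≡0 : r (σ a) ≡ 0) (p∤ra : p ∤ r a)
           where

    open ChipFiring σ τ k′ (σ a)

    module _ (m : ℕ) (uniform : ∀ x m′ → Reaches m′ x → Reaches m x) where

      -- By `uniform`, the vertices that reach the sink are closed under predecessors; injectivity
      -- turns this into closure under successors.
      reaches-σ : ∀ {x} → Reaches m x → Reaches m (σ x)
      reaches-σ = backward⇒forward σ-inj (Reaches m) (λ {x} q → uniform x (suc m) (reaches-backˡ {m} q))

      reaches-τ : ∀ {x} → Reaches m x → Reaches m (τ x)
      reaches-τ = backward⇒forward τ-inj (Reaches m) (λ {x} q → uniform x (suc m) (reaches-backʳ {m} q))

      reaches-a : Reaches m a
      reaches-a = uniform a 1 (reaches-backˡ {0} (reaches-sink 0))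

      stable-multiple : ∀ i → ∃ λ c → (∀ x → x ≢ σ a → c x < k) × c · r ≈ i * r a [mod p ]
      stable-multiple i =
        let c , stable , c≈ = stabilise (Reaches m) reaches-σ reaches-τ _ (descent m) r harmonic
              (point a i) (λ x 0<pt → subst (Reaches m) (sym (point-support a 0<pt)) reaches-a)
              (<-wellFounded _)
        in c , stable , trans c≈ (cong (_% p) (point-· a i r))

    grounded-averaging-bound : p ≤ k ^ n
    -- Arguing by contradiction makes the goal empty, so the uniform bound may be taken out of its
    -- double negation.
    grounded-averaging-bound = ≮⇒≥ λ kⁿ<p →
      ¬¬-uniform Reaches (λ x m≤m′ → reaches-mono x (≤⇒≤′ m≤m′)) λ (m , uniform) →
      <⇒≱ kⁿ<p (representable⇒p≤kⁿ r r-σa≡0 p∤ra (stable-multiple m uniform))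

  -- The coefficients on the two sides have equal sums, so adding a constant to `r` preserves the
  -- relation.
  averaging-bound : ∀ {n} {σ τ : Fin (suc n) → Fin (suc n)} →
                    Injective _≡_ _≡_ σ → Injective _≡_ _≡_ τ →
                    ∀ {k′} .{{_ : NonZero k′}} (r : Fin (suc n) → ℕ) →
                    (∀ a → suc k′ * r a ≈ r (σ a) + k′ * r (τ a) [mod p ]) →
                    ∀ a → ¬ (r (σ a) ≈ r a [mod p ]) →
                    p ≤ suc k′ ^ n
  averaging-bound {σ = σ} {τ} σ-inj τ-inj {k′} r harmonic a rσa≉ra =
    grounded-averaging-bound σ-inj τ-inj r′ harmonic′ a r′σa≡0 p∤r′a
    where
    open ≡-Reasoning
    shift : ℕ
    -- This represents the negative of `r (σ a)` modulo `p`.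
    shift = r (σ a) * pred p
    r′ : Fin _ → ℕ
    r′ x = (r x + shift) % p
    r′≈ : ∀ x → r′ x ≈ r x + shift [mod p ]
    r′≈ x = m%n%n≡m%n (r x + shift) p
    σa-vanishes : r (σ a) + shift ≈ 0 [mod p ]
    σa-vanishes = cong (_% p) (trans (sym (*-suc (r (σ a)) (pred p))) (cong (r (σ a) *_) (suc-pred p)))
                  ⟨ trans ⟩ trans (m*n%n≡0 (r (σ a)) p) (sym (m*n%n≡0 0 p))
    r′σa≡0 : r′ (σ a) ≡ 0
    r′σa≡0 = trans σa-vanishes (m*n%n≡0 0 p)
    p∤r′a : p ∤ r′ a
    p∤r′a p∣r′a = rσa≉ra (+-mod-cancelʳ shift (trans σa-vanishes (sym (begin
      (r a + shift) % p  ≡⟨ r′≈ a ⟨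
      r′ a % p           ≡⟨ n∣m⇒m%n≡0 _ p p∣r′a ⟩
      0                  ≡⟨ m*n%n≡0 0 p ⟨
      0 % p              ∎))))
    regroup : ∀ x y z w → x + z * y + (w + z * w) ≡ (x + w) + z * (y + w)
    regroup = solve-∀
    harmonic′ : ∀ x → suc k′ * r′ x ≈ r′ (σ x) + k′ * r′ (τ x) [mod p ]
    harmonic′ x = begin
      suc k′ * r′ x % p                                    ≡⟨ *-mod-congˡ (suc k′) (r′≈ x) ⟩
      suc k′ * (r x + shift) % p                           ≡⟨ cong (_% p) (*-distribˡ-+ (suc k′) (r x) shift) ⟩
      (suc k′ * r x + suc k′ * shift) % p                  ≡⟨ +-mod-cong (harmonic x) refl ⟩
      (r (σ x) + k′ * r (τ x) + suc k′ * shift) % p        ≡⟨ cong (_% p) (regroup (r (σ x)) (r (τ x)) k′ shift) ⟩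
      ((r (σ x) + shift) + k′ * (r (τ x) + shift)) % p     ≡⟨ +-mod-cong (r′≈ (σ x)) (*-mod-congˡ k′ (r′≈ (τ x))) ⟨
      (r′ (σ x) + k′ * r′ (τ x)) % p                       ∎

  -- Substituting the inverse of `α` gives the previous form. Indexing all three terms by
  -- permutations lets `α` and `β` be exchanged when `k` is replaced by its inverse.
  reindexed-averaging-bound : ∀ {n} {α β γ : Fin n → Fin n} →
    Injective _≡_ _≡_ α → Injective _≡_ _≡_ β → Injective _≡_ _≡_ γ →
    ∀ {k′} .{{_ : NonZero k′}} (r : Fin n → ℕ) →
    (∀ e → suc k′ * r (α e) ≈ r (β e) + k′ * r (γ e) [mod p ]) →
    ∀ e → ¬ (r (β e) ≈ r (α e) [mod p ]) →
    p ≤ suc k′ ^ pred n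
  reindexed-averaging-bound {zero}  _ _ _ _ _ ()
  reindexed-averaging-bound {suc n} {α} {β} {γ} α-inj β-inj γ-inj {k′} r harmonic e rβe≉rαe =
    averaging-bound (g-inj ∘ β-inj) (g-inj ∘ γ-inj) r
      (λ x → subst (λ y → suc k′ * r y ≈ r (β (g x)) + k′ * r (γ (g x)) [mod p ]) (αg≡id x) (harmonic (g x)))
      (α e)
      (subst (λ d → ¬ (r (β d) ≈ r (α e) [mod p ])) (sym gα≡id) rβe≉rαe)
    where
    g : Fin (suc n) → Fin (suc n)
    g x = proj₁ (injective⇒surjective α-inj x)
    αg≡id : ∀ x → α (g x) ≡ x
    αg≡id x = proj₂ (injective⇒surjective α-inj x)
    g-inj : Injective _≡_ _≡_ g
    g-inj {x} {y} gx≡gy = trans (sym (αg≡id x)) (trans (cong α gx≡gy) (αg≡id y))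
    gα≡id : g (α e) ≡ e
    gα≡id = α-inj (αg≡id (α e))

-- Cells as list positions, and the congruences they satisfy.

lookup-injective : ∀ {A : Set} {xs : List A} → Unique xs → Injective _≡_ _≡_ (lookup xs)
lookup-injective (x∉xs ∷ _)  {zero}  {zero}  _  = refl
lookup-injective (x∉xs ∷ _)  {zero}  {suc j} eq = contradiction eq (All-lookup x∉xs (∈-lookup j))
lookup-injective (x∉xs ∷ _)  {suc i} {zero}  eq = contradiction (sym eq) (All-lookup x∉xs (∈-lookup i))
lookup-injective (_ ∷ xs!)   {suc i} {suc j} eq = cong suc (lookup-injective xs! eq)

B⇒≈ : ∀ {p} .{{_ : NonZero p}} k i j {s} → B p k (i , j , s) → toℕ s ≈ k * toℕ i + toℕ j [mod p ]
B⇒≈ {p} k i j refl = trans (cong (_% p) (toℕ-fromℕ< _)) (m%n%n≡m%n (k * toℕ i + toℕ j) p)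

module Arithmetic {p : ℕ} .{{_ : NonZero p}} {k′ : ℕ} where
  open ≡-Reasoning

  -- Here `(x , d)` is a mate cell, `(y , c)` the cell of `T` with the same `k`-symbol, and
  -- `(z , d)` the cell of `T` in the column of the mate cell.
  transversal⇒averaging : ∀ {x y z c d s} → suc k′ * x + d ≈ suc k′ * y + c [mod p ] →
    y + c ≈ s [mod p ] → z + d ≈ s [mod p ] → suc k′ * x ≈ z + k′ * y [mod p ]
  transversal⇒averaging {x} {y} {z} {c} {d} {s} kx+d≈ky+c y+c≈s z+d≈s = +-mod-cancelʳ (z + d) (begin
    (suc k′ * x + (z + d)) % p       ≡⟨ cong (_% p) (swap (suc k′ * x) z d) ⟩
    (z + (suc k′ * x + d)) % p       ≡⟨ +-mod-cong {a = z} refl kx+d≈ky+c ⟩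
    (z + (suc k′ * y + c)) % p       ≡⟨ cong (_% p) (split z k′ y c) ⟩
    (z + k′ * y + (y + c)) % p       ≡⟨ +-mod-cong {a = z + k′ * y} refl (trans y+c≈s (sym z+d≈s)) ⟩
    (z + k′ * y + (z + d)) % p       ∎)
    where
    swap : ∀ a b c → a + (b + c) ≡ b + (a + c)
    swap = solve-∀
    split : ∀ z k y c → z + (y + k * y + c) ≡ z + k * y + (y + c)
    split = solve-∀

  -- Multiply by `l`: then `l * k * x` becomes `x`, and `l * k′` is congruent to `1 - l`, the
  -- negative of `l′`.
  averaging-inverse : ∀ {l′} → suc k′ * suc l′ ≈ 1 [mod p ] → ∀ {x y z} →
    suc k′ * x ≈ z + k′ * y [mod p ] → suc l′ * z ≈ x + l′ * y [mod p ]
  averaging-inverse {l′} kl≈1 {x} {y} {z} kx≈z+k′y = +-mod-cancelʳ y (begin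
    (l * z + y) % p               ≡⟨ +-mod-cong {a = l * z} refl (klw≈w y) ⟨
    (l * z + k * l * y) % p       ≡⟨ cong (_% p) (expand l z k′ y) ⟩
    (l * (z + k′ * y) + l * y) % p ≡⟨ +-mod-cong (*-mod-congˡ l kx≈z+k′y) refl ⟨
    (l * (k * x) + l * y) % p     ≡⟨ cong (λ w → (w + l * y) % p) (reassoc l k x) ⟩
    (k * l * x + l * y) % p       ≡⟨ +-mod-cong (klw≈w x) refl ⟩
    (x + (y + l′ * y)) % p        ≡⟨ cong (_% p) (rotate x y (l′ * y)) ⟩
    (x + l′ * y + y) % p          ∎)
    where
    k l : ℕ
    k = suc k′
    l = suc l′
    klw≈w : ∀ w → k * l * w ≈ w [mod p ]
    klw≈w w = trans (*-mod-congʳ w kl≈1) (cong (_% p) (*-identityˡ w))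
    expand : ∀ l z k y → l * z + (l + k * l) * y ≡ l * (z + k * y) + l * y
    expand = solve-∀
    reassoc : ∀ a b c → a * (b * c) ≡ b * a * c
    reassoc = solve-∀
    rotate : ∀ a b c → a + (b + c) ≡ a + c + b
    rotate = solve-∀

-- The permutations that a symbol of an orthogonal trade induces.

module Trade {p : ℕ} .{{_ : NonZero p}} (p-prime : Prime p)
             {k′ : ℕ} .{{_ : NonZero k′}} (k<p : suc k′ < p)
             {T : TripleSet p} (T? : Decidable T) (trade : IsOrthogonalTrade p 1 (suc k′) T)
             (s : Fin p)
             where

  open IsOrthogonalTrade trade
  open IsDisjointMate isMate
  open IsPartialLatinSquare partialLatin
  open Orthogonal orthogonal using (superimpose)
  open Arithmetic {p} {k′}

  k : ℕ
  k = suc k′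

  n : ℕ
  n = occurrences T? s

  cells : List (Fin p × Fin p)
  cells = filter (λ (i , j) → T? (i , j , s)) (cartesianProduct (allFin p) (allFin p))

  row col : Fin n → Fin p
  row e = proj₁ (lookup cells e)
  col e = proj₂ (lookup cells e)

  cell∈T : ∀ e → T (row e , col e , s)
  cell∈T e = proj₂ (∈-filter⁻ (λ (i , j) → T? (i , j , s)) {xs = cartesianProduct (allFin p) (allFin p)}
                              (∈-lookup {xs = cells} e))

  cell-index : ∀ {i j} → T (i , j , s) → ∃ λ e → (i , j) ≡ (row e , col e)
  cell-index t = index cell∈ , lookup-index cell∈
    where cell∈ = ∈-filter⁺ (λ (i , j) → T? (i , j , s)) (∈-cartesianProduct⁺ (∈-allFin _) (∈-allFin _)) t

  row+col≈ : ∀ i j → B p 1 (i , j , s) → toℕ i + toℕ j ≈ toℕ s [mod p ]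
  row+col≈ i j b = trans (cong (λ x → (x + toℕ j) % p) (sym (*-identityˡ (toℕ i)))) (sym (B⇒≈ 1 i j b))

  cell≈ : ∀ e → toℕ (row e) + toℕ (col e) ≈ toℕ s [mod p ]
  cell≈ e = row+col≈ (row e) (col e) (subset (cell∈T e))

  B-row-unique : ∀ i j j′ → B p 1 (i , j , s) → B p 1 (i , j′ , s) → j ≡ j′
  B-row-unique i j j′ b b′ = toℕ-injective (<⇒mod-inj (toℕ<n j) (toℕ<n j′)
    (+-mod-cancelʳ (toℕ i) (subst₂ _≈_[mod p ] (+-comm (toℕ i) (toℕ j)) (+-comm (toℕ i) (toℕ j′))
      (trans (row+col≈ i j b) (sym (row+col≈ i j′ b′))))))

  row-injective : Injective _≡_ _≡_ row
  row-injective {e} {f} re≡rf = lookup-injective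
    (filter⁺ (λ (i , j) → T? (i , j , s)) (cartesianProduct⁺ (allFin⁺ p) (allFin⁺ p)))
    (cong₂ _,_ re≡rf (B-row-unique (row e) (col e) (col f) (subset (cell∈T e))
      (subst (λ i → B p 1 (i , col f , s)) (sym re≡rf) (subset (cell∈T f)))))

  p∤k′ : p ∤ k′
  p∤k′ = >⇒∤ (<-trans (n<1+n k′) k<p)

  -- On cells with symbol `s` the `k`-symbol is `k′ * i + s` modulo `p`, and `p` does not divide
  -- `k′`.
  k-symbol-injective : ∀ i j i′ j′ → B p 1 (i , j , s) → B p 1 (i′ , j′ , s) →
    k * toℕ i + toℕ j ≈ k * toℕ i′ + toℕ j′ [mod p ] → i ≡ i′
  k-symbol-injective i j i′ j′ b b′ eq = toℕ-injective
    (*-mod-cancelˡ p-prime p∤k′ (toℕ<n i) (toℕ<n i′) (+-mod-cancelʳ (toℕ i′ + toℕ j′) (begin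
      (k′ * toℕ i + (toℕ i′ + toℕ j′)) % p   ≡⟨ +-mod-cong {a = k′ * toℕ i} refl (trans (row+col≈ i′ j′ b′) (sym (row+col≈ i j b))) ⟩
      (k′ * toℕ i + (toℕ i + toℕ j)) % p     ≡⟨ cong (_% p) (peel k′ (toℕ i) (toℕ j)) ⟩
      (k * toℕ i + toℕ j) % p                ≡⟨ eq ⟩
      (k * toℕ i′ + toℕ j′) % p              ≡⟨ cong (_% p) (peel k′ (toℕ i′) (toℕ j′)) ⟨
      (k′ * toℕ i′ + (toℕ i′ + toℕ j′)) % p  ∎)))
    where
    open ≡-Reasoning
    peel : ∀ k x y → k * x + (x + y) ≡ x + k * x + y
    peel = solve-∀

  -- The mate has `s` in the same row; the column where it does so also holds `s` in `T`, at the
  -- cell `f`.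
  mate-cell : ∀ e → ∃ λ f → mate (row e , col f , s)
  mate-cell e
    with j , m ← Equivalence.to (sameInRow (row e) s) (col e , cell∈T e)
    with i , t ← Equivalence.from (sameInCol j s) (row e , m)
    with f , refl ← cell-index t = f , m

  σ : Fin n → Fin n
  σ e = proj₁ (mate-cell e)

  σ∈mate : ∀ e → mate (row e , col (σ e) , s)
  σ∈mate e = proj₂ (mate-cell e)

  σ-injective : Injective _≡_ _≡_ σ
  σ-injective {e} {f} σe≡σf = row-injective
    (col-unique (σ∈mate e) (subst (λ g → mate (row f , col g , s)) (sym σe≡σf) (σ∈mate f)))

  -- A fixed point of `σ` would put a triple in both `T` and its mate.
  row-σ≢ : ∀ e → row (σ e) ≢ row e
  row-σ≢ e eq = disjoint
    (cell∈T e , subst (λ f → mate (row e , col f , s)) (row-injective eq) (σ∈mate e))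

  k-symbol : Fin p → Fin p → ℕ
  k-symbol i j = k * toℕ i + toℕ j

  mate-same-k-symbol : ∀ b → ∃ λ e → k-symbol (row e) (col (σ e)) ≈ k-symbol (row b) (col b) [mod p ]
  mate-same-k-symbol b
    with superimpose s (k-symbol (row b) (col b) mod p)
  -- In the unchanged part of the square, a cell with symbol `s` and this `k`-symbol would have to
  -- be cell `b`, which lies in `T`.
  ... | (i , j) , (inj₁ (b₁ , ∉T) , bₖ) , _
    with refl ← k-symbol-injective i j (row b) (col b) b₁ (subset (cell∈T b)) (trans (sym (B⇒≈ k i j bₖ)) (B⇒≈ k (row b) (col b) refl))
    with refl ← B-row-unique i j (col b) b₁ (subset (cell∈T b)) = contradiction (cell∈T b) ∉T
  mate-same-k-symbol b
      | (i , j) , (inj₂ m , bₖ) , _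
    with _ , t ← Equivalence.from (sameInRow i s) (j , m)
    with e , refl ← cell-index t
    with refl ← row-unique m (σ∈mate e) = e , trans (sym (B⇒≈ k i j bₖ)) (B⇒≈ k (row b) (col b) refl)

  -- The inverse of the permutation τ.
  ρ : Fin n → Fin n
  ρ b = proj₁ (mate-same-k-symbol b)

  ρ-k-symbol : ∀ b → k-symbol (row (ρ b)) (col (σ (ρ b))) ≈ k-symbol (row b) (col b) [mod p ]
  ρ-k-symbol b = proj₂ (mate-same-k-symbol b)

  ρ-injective : Injective _≡_ _≡_ ρ
  ρ-injective {b} {b′} ρb≡ρb′ = row-injective
    (k-symbol-injective (row b) (col b) (row b′) (col b′) (subset (cell∈T b)) (subset (cell∈T b′))
      (trans (sym (ρ-k-symbol b))
        (trans (cong (λ e → k-symbol (row e) (col (σ e)) % p) ρb≡ρb′) (ρ-k-symbol b′))))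

  r : Fin n → ℕ
  r e = toℕ (row e)

  averaging : ∀ b → k * r (ρ b) ≈ r (σ (ρ b)) + k′ * r b [mod p ]
  averaging b = transversal⇒averaging (ρ-k-symbol b) (cell≈ b) (cell≈ (σ (ρ b)))

  r-σ≉ : ∀ e → ¬ (r (σ e) ≈ r e [mod p ])
  r-σ≉ e eq = row-σ≢ e (toℕ-injective (<⇒mod-inj (toℕ<n (row (σ e))) (toℕ<n (row e)) eq))

  p≤kⁿ⁻¹ : Fin n → p ≤ k ^ pred n
  p≤kⁿ⁻¹ b = reindexed-averaging-bound p-prime ρ-injective (ρ-injective ∘ σ-injective) id r
    averaging b (r-σ≉ (ρ b))

  -- The roles of `ρ` and `σ ∘ ρ` are exchanged.
  p≤lⁿ⁻¹ : ∀ {l′} .{{_ : NonZero l′}} → k * suc l′ ≈ 1 [mod p ] → Fin n → p ≤ suc l′ ^ pred n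
  p≤lⁿ⁻¹ kl≈1 b = reindexed-averaging-bound p-prime (ρ-injective ∘ σ-injective) ρ-injective id r
    (averaging-inverse kl≈1 ∘ averaging) b (r-σ≉ (ρ b) ∘ sym)

  occurrence : OccursIn s T → Fin n
  occurrence (_ , _ , t) = proj₁ (cell-index t)

-- From the power bound to the strict logarithmic bound.

prime≤^⇒>log : ∀ {p K} n → Prime p → 2 ≤ K → K < p → p ≤ K ^ pred n → n >log[ K ] p +1
-- For `n` at most 1 the exponent `pred n` is 0, forcing `p ≤ 1`.
prime≤^⇒>log zero          p-prime 2≤K K<p p≤1 = contradiction (≤-trans 2≤K (≤-trans (<⇒≤ K<p) p≤1)) λ where (s≤s ())
prime≤^⇒>log (suc zero)    p-prime 2≤K K<p p≤1 = contradiction (≤-trans 2≤K (≤-trans (<⇒≤ K<p) p≤1)) λ where (s≤s ())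
prime≤^⇒>log {p} {K} (suc (suc m)) p-prime 2≤K K<p p≤Kᵐ⁺¹ =
  *-monoʳ-< K {{>-nonZero (<-trans z<s 2≤K)}} (≤∧≢⇒< p≤Kᵐ⁺¹ p≢Kᵐ⁺¹)
  where
  p≢Kᵐ⁺¹ : p ≢ K ^ suc m
  -- Equality would make `K` a divisor of the prime `p` other than 1 and `p`.
  p≢Kᵐ⁺¹ eq with prime⇒irreducible p-prime (subst (K ∣_) (sym eq) (m∣m*n (K ^ m)))
  ... | inj₁ K≡1 = <⇒≢ 2≤K (sym K≡1)
  ... | inj₂ K≡p = <⇒≢ K<p K≡p

-- The residue of an inverse is again an inverse, so the least one is below `p`; 0 and 1 would force
-- `0 ≡ 1` and `k ≡ 1` modulo `p`.
least-inverse-bounds : ∀ {p} .{{_ : NonZero p}} {k k⁻¹} → 2 ≤ k → k < p →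
                       IsLeastInverse p k k⁻¹ → 2 ≤ k⁻¹ × k⁻¹ < p
least-inverse-bounds {p} {k} {k⁻¹} 2≤k k<p inv = lower k⁻¹ inverse ,
  ≤-<-trans (least (k⁻¹ % p) (trans (*-mod-congˡ k (m%n%n≡m%n k⁻¹ p)) inverse)) (m%n<n k⁻¹ p)
  where
  open IsLeastInverse inv
  1<p : 1 < p
  1<p = <-trans 2≤k k<p
  lower : ∀ l → (k * l) % p ≡ 1 % p → 2 ≤ l
  lower zero          k0≈1 = contradiction
    (<⇒mod-inj (<-trans z<s 1<p) 1<p (trans (cong (_% p) (sym (*-zeroʳ k))) k0≈1)) λ ()
  lower (suc zero)    k1≈1 = contradiction
    (sym (<⇒mod-inj k<p 1<p (trans (cong (_% p) (sym (*-identityʳ k))) k1≈1))) (<⇒≢ 2≤k)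
  lower (suc (suc _)) _    = s≤s (s≤s z≤n)

theorem3p4 : (p : ℕ) .{{_ : NonZero p}} → Prime p → 2 ∤ p →
    (k : ℕ) → 2 ≤ k → k ≤ p ∸ 1 →
    (k⁻¹ : ℕ) → IsLeastInverse p k k⁻¹ →
    (T : TripleSet p) (T? : Decidable T) → IsOrthogonalTrade p 1 k T →
    (s : Fin p) → OccursIn s T →
    occurrences T? s >log[ k ⊓ k⁻¹ ] p +1
theorem3p4 p p-prime _ k@(suc (suc _)) 2≤k k≤p-1 k⁻¹ inv T T? trade s s∈T =
  bound (least-inverse-bounds 2≤k k<p inv)
  where
  k<p : k < p
  k<p = subst (k <_) (suc-pred p) (s≤s k≤p-1)
  open Trade p-prime k<p T? trade s using (p≤kⁿ⁻¹; p≤lⁿ⁻¹; occurrence)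
  bound : 2 ≤ k⁻¹ × k⁻¹ < p → occurrences T? s >log[ k ⊓ k⁻¹ ] p +1
  bound (2≤k⁻¹@(s≤s (s≤s _)) , k⁻¹<p) with ⊓-sel k k⁻¹
  ... | inj₁ eq = subst (λ K → occurrences T? s >log[ K ] p +1) (sym eq)
    (prime≤^⇒>log (occurrences T? s) p-prime 2≤k k<p (p≤kⁿ⁻¹ (occurrence s∈T)))
  ... | inj₂ eq = subst (λ K → occurrences T? s >log[ K ] p +1) (sym eq)
    (prime≤^⇒>log (occurrences T? s) p-prime 2≤k⁻¹ k⁻¹<p
      (p≤lⁿ⁻¹ (IsLeastInverse.inverse inv) (occurrence s∈T)))
theorem3p4 p _ _ zero       ()
theorem3p4 p _ _ (suc zero) (s≤s ())
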